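{- Let $\mu>0$ be a real number, and let $(n_k)_{k\in\mathbb{N}}$ be a sequence of positive integers such that $n_k=p_k^{j_k}$ for all $k$, where $p_k$ is a prime and $j_k\in\mathbb{N}$. Then $T_{n_k}(\mu)\to\infty$ as $j_k\to\infty$; that is, for every $E>0$ there exists $A>0$ such that, for every $k$, $j_k>A$ implies $T_{n_k}(\mu)>E$.
   Context: $\mathbb{N}$ is the set of positive integers. $\tau(n)$ denotes the number of positive divisors of the positive integer $n$. For real $\mu>0$ and a positive integer $n$, $$T_n(\mu)=\frac{\max_{1\le m\le n^{1/\mu}}\tau(n+m)}{\tau(n)},$$ where the maximum is over integers $m$ in the indicated range. Here $p_k$ denotes an arbitrary prime depending on $k$ (not the $k$-th prime). -}

module Defs where

open import Data.Empty using (⊥)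
open import Data.Integer using (+_; ∣_∣)
open import Data.List using (length; filter; applyUpTo)
open import Data.List.Properties using (filter-accept)
open import Data.Nat as ℕ using (ℕ; suc; NonZero)
open import Data.Nat.Divisibility using (_∣?_; 1∣_)
open import Data.Product using (_×_; _,_; ∃-syntax)
open import Data.Rational using (ℚ; 0ℚ; 1ℚ; ↥_; ↧ₙ_; _+_; _-_; -_; _*_; _/_; _<_; _≤_; _<?_; +-*-rawSemiring)
open import Data.Rational.Properties using (<-dense; <-trans; <-asym; ≮⇒≥; <-≤-trans; ≤-<-trans; +-identityʳ; +-monoʳ-<)
open import Data.Sum using (_⊎_; inj₁; inj₂)
open import Function using (_⇔_; mk⇔)
open import Relation.Binary.PropositionalEquality using (subst)
open import Relation.Nullary using (yes; no)
open import Relation.Nullary.Decidable using (from-yes)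
open import Algebra.Definitions.RawSemiring +-*-rawSemiring using (_^_)

τ : ℕ → ℕ
τ n = length (filter (_∣? n) (applyUpTo suc n))

τ-nonZero : ∀ n .{{_ : NonZero n}} → NonZero (τ n)
τ-nonZero (suc n)
  rewrite filter-accept (_∣? suc n) {x = 1} {xs = applyUpTo (λ i → suc (suc i)) n} (1∣ suc n) = _

fromℕ : ℕ → ℚ
fromℕ n = + n / 1

-- A pair of sets of rationals: lower x q reads q < x, and upper x q reads x < q.
record Cut : Set₁ where
  field
    lower : ℚ → Set
    upper : ℚ → Set

open Cut public

-- Dedekind reals.
record ℝ : Set₁ where
  field
    cut             : Cut
    lower-inhabited : ∃[ q ] lower cut q
    upper-inhabited : ∃[ q ] upper cut q
    lower-rounded   : ∀ q → lower cut q ⇔ (∃[ r ] q < r × lower cut r)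
    upper-rounded   : ∀ q → upper cut q ⇔ (∃[ r ] r < q × upper cut r)
    disjoint        : ∀ q → lower cut q → upper cut q → ⊥
    located         : ∀ q r → q < r → lower cut q ⊎ upper cut r

open ℝ public using (cut)

infix 4 _<ᶜ_ _≤ᶜ_ _≈ᶜ_

_<ᶜ_ : Cut → Cut → Set
x <ᶜ y = ∃[ q ] upper x q × lower y q

_≤ᶜ_ : Cut → Cut → Set
x ≤ᶜ y = ∀ q → lower x q → lower y q

_≈ᶜ_ : Cut → Cut → Set
x ≈ᶜ y = (∀ q → lower x q ⇔ lower y q) × (∀ q → upper x q ⇔ upper y q)

rat : ℚ → Cut
rat p = record { lower = _< p ; upper = p <_ }

nat : ℕ → Cut
nat n = rat (fromℕ n)

fromℚ : ℚ → ℝ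
fromℚ p = record
  { cut             = rat p
  ; lower-inhabited = p - 1ℚ , subst (p - 1ℚ <_) (+-identityʳ p) (+-monoʳ-< p -1<0)
  ; upper-inhabited = p + 1ℚ , subst (_< p + 1ℚ) (+-identityʳ p) (+-monoʳ-< p 0<1)
  ; lower-rounded   = λ q → mk⇔ (λ q<p → let r , q<r , r<p = <-dense q<p in r , q<r , r<p)
                                (λ (r , q<r , r<p) → <-trans q<r r<p)
  ; upper-rounded   = λ q → mk⇔ (λ p<q → let r , p<r , r<q = <-dense p<q in r , r<q , p<r)
                                (λ (r , r<q , p<r) → <-trans p<r r<q)
  ; disjoint        = λ q → <-asym
  ; located         = loc
  }
  where
  -1<0 : - 1ℚ < 0ℚ
  -1<0 = from-yes (- 1ℚ <? 0ℚ)
  0<1 : 0ℚ < 1ℚ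
  0<1 = from-yes (0ℚ <? 1ℚ)
  loc : ∀ q r → q < r → q < p ⊎ p < r
  loc q r q<r with q <? p
  ... | yes q<p = inj₁ q<p
  ... | no  q≮p = inj₂ (≤-<-trans (≮⇒≥ q≮p) q<r)

infix 8 1/ᶜ_
infix 9 _^ᶜ_
infixl 7 _/ᶜ_

-- For x > 0: q < 1/x iff q s < 1 for some s > x, and dually.
1/ᶜ_ : Cut → Cut
1/ᶜ x = record
  { lower = λ q → ∃[ s ] upper x s × q * s < 1ℚ
  ; upper = λ q → ∃[ s ] lower x s × 0ℚ < s × 1ℚ < q * s
  }

-- For n ≥ 1 and y > 0: r ↦ n ^ r is monotone and continuous, so n ^ y is the supremum of
-- the n ^ r over rationals 0 ≤ r < y and the infimum of those over rationals r > y.  For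
-- r = a / b ≥ 0 and q ≥ 0, q < n ^ r means q ^ b < n ^ a.
_^ᶜ_ : ℕ → Cut → Cut
n ^ᶜ y = record
  { lower = λ q → ∃[ r ] lower y r × 0ℚ ≤ r
                       × (q < 0ℚ ⊎ q ^ (↧ₙ r) < fromℕ n ^ ∣ ↥ r ∣)
  ; upper = λ q → ∃[ r ] upper y r × 0ℚ < r
                       × 0ℚ < q × fromℕ n ^ ∣ ↥ r ∣ < q ^ (↧ₙ r)
  }

_/ᶜ_ : Cut → (d : ℕ) .{{_ : NonZero d}} → Cut
x /ᶜ d = record
  { lower = λ q → lower x (q * fromℕ d)
  ; upper = λ q → upper x (q * fromℕ d)
  }

-- The maximum of f over { m | P m }, as a cut: selecting a largest element would need P
-- to be decidable, and m ≤ n ^ (1/μ) is not decidable for an arbitrary real μ.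
-- By max-attained this agrees with the maximum whenever one is exhibited.
max : (P : ℕ → Set) (f : ℕ → ℕ) → Cut
max P f = record
  { lower = λ q → ∃[ m ] P m × q < fromℕ (f m)
  ; upper = λ q → ∃[ r ] r < q × (∀ m → P m → fromℕ (f m) ≤ r)
  }

max-attained : ∀ P f m → P m → (∀ k → P k → fromℕ (f k) ≤ fromℕ (f m)) →
               max P f ≈ᶜ nat (f m)
max-attained P f m Pm ub =
    (λ q → mk⇔ (λ (k , Pk , q<fk) → <-≤-trans q<fk (ub k Pk)) (λ q<fm → m , Pm , q<fm))
  , (λ q → mk⇔ (λ (r , r<q , ubr) → ≤-<-trans (ubr m Pm) r<q) (λ fm<q → fromℕ (f m) , fm<q , ub))

T : (n : ℕ) .{{_ : NonZero n}} → ℝ → Cut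
T n μ = _/ᶜ_ (max (λ m → 1 ℕ.≤ m × nat m ≤ᶜ n ^ᶜ (1/ᶜ cut μ)) (λ m → τ (n ℕ.+ m)))
             (τ n) {{τ-nonZero n}}

module Submission where

-- Some m with 1 ≤ m ≤ d makes n + m a multiple of d.  Taking d = 2^a 3^a gives
-- τ (n + m) ≥ (a + 1)², while τ (p^j) = j + 1.  As p ≥ 2, it is enough for the range of m
-- that d ≤ 2^(3a) and 3a(M + 1) ≤ j for an integer M > μ, so a grows linearly in j and (a + 1)² outgrows
-- every multiple of j + 1, uniformly in p.

open import Defs
open import Data.Integer as ℤ using (+_; -[1+_])
import Data.Integer.Properties as ℤ
open import Data.List using (List; []; _∷_; _++_; length; map; applyUpTo; upTo; cartesianProductWith)
open import Data.List.Properties using (length-++; length-++-sucʳ; length-map; length-upTo)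
open import Data.List.Membership.Propositional using (_∈_)
open import Data.List.Membership.Propositional.Properties
  using (∈-∃++; ∈-++⁻; ∈-++⁺ˡ; ∈-++⁺ʳ; ∈-applyUpTo⁺; ∈-filter⁺; ∈-filter⁻; ∈-map⁺;
          ∈-upTo⁺; ∈-upTo⁻; ∈-cartesianProductWith⁻)
open import Data.List.Relation.Binary.Subset.Propositional using (_⊆_)
open import Data.List.Relation.Unary.Any using (here; there)
open import Data.List.Relation.Unary.AllPairs using (_∷_)
open import Data.List.Relation.Unary.Unique.Propositional using (Unique)
import Data.List.Relation.Unary.Unique.Propositional.Properties as Unique
open import Data.Nat
  using (ℕ; zero; suc; NonZero; nonTrivial⇒≢1; nonTrivial⇒n>1; >-nonZero; ≢-nonZero⁻¹;
          _^_; _+_; _*_; _∸_; _≤_; _<_; z≤n; s≤s; _/_; _%_)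
open import Data.Nat.Coprimality using (1-coprimeTo)
import Data.Nat.Coprimality as Coprime
open import Data.Nat.Divisibility
open import Data.Nat.DivMod using (m≡m%n+[m/n]*n; m%n<n; m/n*n≤m; m*n/n≡m; /-monoˡ-≤)
open import Data.Nat.Primality using (Prime; prime?; prime⇒nonZero; prime⇒nonTrivial; euclidsLemma)
open import Data.Nat.Properties
open import Data.Nat.Tactic.RingSolver using (solve-∀)
open import Data.Product using (_×_; ∃-syntax; _,_)
open import Data.Rational as ℚ using (ℚ; mkℚ; 0ℚ; 1ℚ; *<*)
import Data.Rational.Properties as ℚ
open import Algebra.Definitions.RawSemiring ℚ.+-*-rawSemiring using () renaming (_^_ to _^ℚ_)
open import Data.Sum using (_⊎_; inj₁; inj₂)
open import Function using (_∘_; module Equivalence)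
open import Level using (Level)
open import Relation.Binary using (tri<; tri≈; tri>)
open import Relation.Binary.PropositionalEquality
  using (_≡_; refl; sym; trans; cong; cong₂; subst; subst₂; module ≡-Reasoning)
open import Relation.Nullary using (¬_; yes; no; contradiction)
open import Relation.Nullary.Decidable using (from-yes; from-no)

-- Lengths of duplicate-free lists and of product lists.

private
  variable
    ℓ : Level
    A B C : Set ℓ

-- Induction on `xs`: deleting one occurrence of the head `x` from `ys` leaves a list that still
-- contains the tail, because by uniqueness `x` does not recur there.
length-mono-⊆ : {xs ys : List A} → Unique xs → xs ⊆ ys → length xs ≤ length ys
length-mono-⊆ {xs = []} _ _ = z≤n
length-mono-⊆ {xs = x ∷ xs} {ys} u@(_ ∷ uxs) xs⊆ys
  with as , bs , refl ← ∈-∃++ (xs⊆ys (here refl)) = begin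
  suc (length xs)         ≤⟨ s≤s (length-mono-⊆ uxs xs⊆as++bs) ⟩
  suc (length (as ++ bs)) ≡⟨ length-++-sucʳ as x bs ⟨
  length (as ++ x ∷ bs)   ∎
  where
  open ≤-Reasoning
  xs⊆as++bs : xs ⊆ as ++ bs
  xs⊆as++bs z∈xs with ∈-++⁻ as (xs⊆ys (there z∈xs))
  ... | inj₁ z∈as         = ∈-++⁺ˡ z∈as
  ... | inj₂ (here refl)  = contradiction z∈xs (Unique.Unique[x∷xs]⇒x∉xs u)
  ... | inj₂ (there z∈bs) = ∈-++⁺ʳ as z∈bs

length-cartesianProductWith : (f : A → B → C) (xs : List A) (ys : List B) →
                              length (cartesianProductWith f xs ys) ≡ length xs * length ys
length-cartesianProductWith f []       ys = refl
length-cartesianProductWith f (x ∷ xs) ys = trans (length-++ (map (f x) ys))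
  (cong₂ _+_ (length-map (f x) ys) (length-cartesianProductWith f xs ys))

-- Powers and prime factors.

^-injectiveʳ : ∀ {m} → 1 < m → ∀ {x y} → m ^ x ≡ m ^ y → x ≡ y
^-injectiveʳ {m} 1<m {x} {y} eq with <-cmp x y
... | tri< x<y _ _ = contradiction eq (<⇒≢ (^-monoʳ-< m 1<m x<y))
... | tri≈ _ x≡y _ = x≡y
... | tri> _ _ y<x = contradiction (sym eq) (<⇒≢ (^-monoʳ-< m 1<m y<x))

m≤n⇒b^m∣b^n : ∀ b {m n} → m ≤ n → b ^ m ∣ b ^ n
m≤n⇒b^m∣b^n b {n = n} z≤n = 1∣ (b ^ n)
m≤n⇒b^m∣b^n b (s≤s m≤n)   = *-monoʳ-∣ b (m≤n⇒b^m∣b^n b m≤n)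

prime∣^⇒∣ : ∀ {p} → Prime p → ∀ m k → p ∣ m ^ k → p ∣ m
prime∣^⇒∣ pp m zero p∣1 =
  contradiction (∣1⇒≡1 p∣1) (nonTrivial⇒≢1 {{prime⇒nonTrivial pp}})
prime∣^⇒∣ pp m (suc k) p∣ with euclidsLemma m (m ^ k) pp p∣
... | inj₁ p∣m  = p∣m
... | inj₂ p∣mᵏ = prime∣^⇒∣ pp m k p∣mᵏ

-- Factors `p` are cancelled while both exponents of `p` are positive. If only one of them reaches
-- zero, `p` divides one side but not the other; if both do, powers of `m` remain.
p^x*m^y-injective : ∀ {p m} → Prime p → ¬ p ∣ m → 1 < m →
                    ∀ {x x′ y y′} → p ^ x * m ^ y ≡ p ^ x′ * m ^ y′ → x ≡ x′ × y ≡ y′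
p^x*m^y-injective {p} {m} pp p∤m 1<m = go _ _
  where
  instance _ = prime⇒nonZero pp
  p∣pˣ⁺¹* : ∀ x y → p ∣ p ^ suc x * m ^ y
  p∣pˣ⁺¹* x y = ∣m⇒∣m*n (m ^ y) (m∣m*n (p ^ x))
  p∤1*m^ : ∀ y → ¬ p ∣ 1 * m ^ y
  p∤1*m^ y = p∤m ∘ prime∣^⇒∣ pp m y ∘ subst (p ∣_) (*-identityˡ (m ^ y))
  go : ∀ x x′ {y y′} → p ^ x * m ^ y ≡ p ^ x′ * m ^ y′ → x ≡ x′ × y ≡ y′
  go zero zero {y} {y′} eq =
    refl , ^-injectiveʳ 1<m (*-cancelˡ-≡ (m ^ y) (m ^ y′) 1 eq)
  go zero (suc x′) {y} {y′} eq =
    contradiction (subst (p ∣_) (sym eq) (p∣pˣ⁺¹* x′ y′)) (p∤1*m^ y)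
  go (suc x) zero {y} {y′} eq =
    contradiction (subst (p ∣_) eq (p∣pˣ⁺¹* x y)) (p∤1*m^ y′)
  go (suc x) (suc x′) {y} {y′} eq
    with refl , refl ← go x x′ {y} {y′} (*-cancelˡ-≡ _ _ p
      (trans (sym (*-assoc p (p ^ x) (m ^ y))) (trans eq (*-assoc p (p ^ x′) (m ^ y′)))))
    = refl , refl

-- In `p ^ suc k ≡ e * d` the prime divides `e` or `d`. Cancelling it there leaves a factorisation
-- of `p ^ k`, with the same `d` in the first case and with `d` divided by `p` in the second.
∣p^k⇒≡p^i : ∀ {p} → Prime p → ∀ k {d} → d ∣ p ^ k → ∃[ i ] i ≤ k × d ≡ p ^ i
∣p^k⇒≡p^i pp zero d∣1 = 0 , z≤n , ∣1⇒≡1 d∣1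
∣p^k⇒≡p^i {p} pp (suc k) {d} (divides e eq)
  with p ∣? e
... | yes (divides f refl)
  with i , i≤k , d≡ ← ∣p^k⇒≡p^i pp k (divides f (*-cancelˡ-≡ (p ^ k) (f * d) p {{prime⇒nonZero pp}}
         (trans eq (trans (cong (_* d) (*-comm f p)) (*-assoc p f d)))))
  = i , m≤n⇒m≤1+n i≤k , d≡
... | no p∤e with euclidsLemma e d pp (subst (p ∣_) eq (m∣m*n (p ^ k)))
...   | inj₁ p∣e = contradiction p∣e p∤e
...   | inj₂ (divides d′ refl)
  with i , i≤k , refl ← ∣p^k⇒≡p^i pp k (divides e (*-cancelʳ-≡ (p ^ k) (e * d′) p {{prime⇒nonZero pp}}
         (trans (*-comm (p ^ k) p) (trans eq (sym (*-assoc e d′ p))))))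
  = suc i , s≤s i≤k , *-comm (p ^ i) p

-- Bounds on the number of divisors.

length≤τ : ∀ n .{{_ : NonZero n}} {xs} → Unique xs → (∀ {d} → d ∈ xs → d ∣ n) → length xs ≤ τ n
length≤τ n uxs xs∣n = length-mono-⊆ uxs λ d∈xs →
  ∈-filter⁺ (_∣? n) (∈-suc (xs∣n d∈xs)) (xs∣n d∈xs)
  where
  ∈-suc : ∀ {d} → d ∣ n → d ∈ applyUpTo suc n
  ∈-suc {zero}  0∣n = contradiction (0∣⇒≡0 0∣n) (≢-nonZero⁻¹ n)
  ∈-suc {suc d} d∣n = ∈-applyUpTo⁺ suc (∣⇒≤ d∣n)

τ≤length : ∀ n {xs} → (∀ {d} → d ∣ n → d ∈ xs) → τ n ≤ length xs
τ≤length n ∣n⇒∈ = length-mono-⊆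
  (Unique.filter⁺ (_∣? n) (Unique.applyUpTo⁺₁ suc n λ i<j _ → <⇒≢ (s≤s i<j)))
  λ d∈ → let _ , d∣n = ∈-filter⁻ (_∣? n) {xs = applyUpTo suc n} d∈ in ∣n⇒∈ d∣n

τ[p^k]≤1+k : ∀ {p} → Prime p → ∀ k → τ (p ^ k) ≤ suc k
τ[p^k]≤1+k {p} pp k = ≤-trans (τ≤length (p ^ k) ∈-powers)
  (≤-reflexive (trans (length-map (p ^_) (upTo (suc k))) (length-upTo (suc k))))
  where
  ∈-powers : ∀ {d} → d ∣ p ^ k → d ∈ map (p ^_) (upTo (suc k))
  ∈-powers d∣ with i , i≤k , refl ← ∣p^k⇒≡p^i pp k d∣ = ∈-map⁺ (p ^_) (∈-upTo⁺ (s≤s i≤k))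

-- The products `p ^ x * m ^ y` with `x ≤ a` and `y ≤ b` are pairwise distinct and all divide `n`.
[1+a]*[1+b]≤τ : ∀ {p m} → Prime p → ¬ p ∣ m → 1 < m →
                ∀ a b {n} .{{_ : NonZero n}} → p ^ a * m ^ b ∣ n → suc a * suc b ≤ τ n
[1+a]*[1+b]≤τ {p} {m} pp p∤m 1<m a b {n} pᵃmᵇ∣n =
  subst (_≤ τ n)
    (trans (length-cartesianProductWith f (upTo (suc a)) (upTo (suc b)))
           (cong₂ _*_ (length-upTo (suc a)) (length-upTo (suc b))))
    (length≤τ n
      (Unique.cartesianProductWith⁺ f (λ eq → p^x*m^y-injective pp p∤m 1<m eq)
        (Unique.upTo⁺ (suc a)) (Unique.upTo⁺ (suc b)))
      f∣n)
  where
  f : ℕ → ℕ → ℕ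
  f x y = p ^ x * m ^ y
  f∣n : ∀ {d} → d ∈ cartesianProductWith f (upTo (suc a)) (upTo (suc b)) → d ∣ n
  f∣n d∈ with x , y , x∈ , y∈ , refl ← ∈-cartesianProductWith⁻ f (upTo (suc a)) (upTo (suc b)) d∈ =
    ∣-trans (*-pres-∣ (m≤n⇒b^m∣b^n p (≤-pred (∈-upTo⁻ x∈))) (m≤n⇒b^m∣b^n m (≤-pred (∈-upTo⁻ y∈)))) pᵃmᵇ∣n

-- A small shift with many divisors.

∃-multiple-after : ∀ n d .{{_ : NonZero d}} → ∃[ m ] 1 ≤ m × m ≤ d × d ∣ n + m
-- When `d` divides `n` this witness is `d` and not 0, which keeps `1 ≤ m`.
∃-multiple-after n d = d ∸ n % d , m<n⇒0<n∸m (m%n<n n d) , m∸n≤m d (n % d) ,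
  divides (suc (n / d)) (begin
  n + (d ∸ n % d)                         ≡⟨ cong (_+ (d ∸ n % d)) (m≡m%n+[m/n]*n n d) ⟩
  n % d + n / d * d + (d ∸ n % d)         ≡⟨ cong (_+ (d ∸ n % d)) (+-comm (n % d) _) ⟩
  n / d * d + n % d + (d ∸ n % d)         ≡⟨ +-assoc (n / d * d) _ _ ⟩
  n / d * d + (n % d + (d ∸ n % d))       ≡⟨ cong (λ r → n / d * d + r) (m+[n∸m]≡n (<⇒≤ (m%n<n n d))) ⟩
  n / d * d + d                           ≡⟨ +-comm _ d ⟩
  suc (n / d) * d                         ∎)
  where open ≡-Reasoning

m<[1+m/n]*n : ∀ m n .{{_ : NonZero n}} → m < suc (m / n) * n
m<[1+m/n]*n m n = begin-strict
  m                   ≡⟨ m≡m%n+[m/n]*n m n ⟩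
  m % n + m / n * n   <⟨ +-monoˡ-< (m / n * n) (m%n<n m n) ⟩
  suc (m / n) * n     ∎
  where open ≤-Reasoning

2^a*3^a≤2^[3*a] : ∀ a → 2 ^ a * 3 ^ a ≤ 2 ^ (3 * a)
2^a*3^a≤2^[3*a] a = begin
  2 ^ a * 3 ^ a       ≤⟨ *-monoʳ-≤ (2 ^ a) (^-monoˡ-≤ a (n≤1+n 3)) ⟩
  2 ^ a * (2 ^ 2) ^ a ≡⟨ cong ((2 ^ a) *_) (^-*-assoc 2 2 a) ⟩
  2 ^ a * 2 ^ (2 * a) ≡⟨ ^-distribˡ-+-* 2 a (2 * a) ⟨
  2 ^ (3 * a)         ∎
  where open ≤-Reasoning

-- With `K = 3(M + 1)` and `a` the integer part of `j / K`, the hypothesis says `K²B ≤ j` and hence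
-- `KB ≤ a`. The bound on `m ^ suc M` is the integer form of `m ≤ (p ^ j)^(1/(M+1))`.
∃-shift-with-many-divisors : ∀ {p} → Prime p → ∀ j M B →
  suc M * 3 * (suc M * 3) * B ≤ j →
  ∃[ m ] 1 ≤ m × m ^ suc M ≤ p ^ j × B * τ (p ^ j) < τ (p ^ j + m)
∃-shift-with-many-divisors {p} pp j M B K²B≤j
  with m , 1≤m , m≤d , d∣n+m ← ∃-multiple-after (p ^ j)
         (2 ^ (j / (suc M * 3)) * 3 ^ (j / (suc M * 3)))
         {{m*n≢0 _ _ {{m^n≢0 2 (j / (suc M * 3))}} {{m^n≢0 3 (j / (suc M * 3))}}}}
  = m , 1≤m , m^[1+M]≤p^j m≤d , (begin-strict
      B * τ (p ^ j)         ≤⟨ *-monoʳ-≤ B (τ[p^k]≤1+k pp j) ⟩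
      -- The strict bound `j < suc a * K` on naturals absorbs the successor in `suc j`.
      B * suc j             ≤⟨ *-monoʳ-≤ B (m<[1+m/n]*n j K) ⟩
      B * (suc a * K)       ≡⟨ xyz≡yzx B (suc a) K ⟩
      suc a * (K * B)       <⟨ *-monoʳ-< (suc a) (s≤s KB≤a) ⟩
      suc a * suc a         ≤⟨ [1+a]*[1+b]≤τ (from-yes (prime? 2)) (from-no (2 ∣? 3)) (s≤s (s≤s z≤n)) a a
                                 {{m+n≢0ˡ}} d∣n+m ⟩
      τ (p ^ j + m)         ∎)
  where
  open ≤-Reasoning
  K = suc M * 3
  a = j / K
  instance _ = prime⇒nonZero pp
  m+n≢0ˡ : ∀ {m} → NonZero (p ^ j + m)
  m+n≢0ˡ {m} = >-nonZero (≤-trans (m^n>0 p j) (m≤m+n (p ^ j) m))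
  xyz≡yzx : ∀ x y z → x * (y * z) ≡ y * (z * x)
  xyz≡yzx = solve-∀
  KB≤a : K * B ≤ a
  KB≤a = begin
    K * B         ≡⟨ m*n/n≡m (K * B) K ⟨
    K * B * K / K ≤⟨ /-monoˡ-≤ K (≤-trans (≤-reflexive (trans (*-comm (K * B) K) (sym (*-assoc K K B)))) K²B≤j) ⟩
    a             ∎
  m^[1+M]≤p^j : ∀ {m} → m ≤ 2 ^ a * 3 ^ a → m ^ suc M ≤ p ^ j
  m^[1+M]≤p^j {m} m≤d = begin
    m ^ suc M               ≤⟨ ^-monoˡ-≤ (suc M) (≤-trans m≤d (2^a*3^a≤2^[3*a] a)) ⟩
    (2 ^ (3 * a)) ^ suc M   ≡⟨ ^-*-assoc 2 (3 * a) (suc M) ⟩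
    -- The exponent equals `a * K`, which is at most `j`.
    2 ^ (3 * a * suc M)     ≤⟨ ^-monoʳ-≤ 2 (≤-trans (≤-reflexive (3xy≡x[3y] a (suc M))) (m/n*n≤m j K)) ⟩
    2 ^ j                   ≤⟨ ^-monoˡ-≤ j (nonTrivial⇒n>1 p {{prime⇒nonTrivial pp}}) ⟩
    p ^ j                   ∎
    where
    3xy≡x[3y] : ∀ x y → 3 * x * y ≡ x * (y * 3)
    3xy≡x[3y] = solve-∀

-- Naturals among the rationals.

-- `fromℕ n` is normalised through a gcd, which does not compute for a variable `n`; rewriting to
-- the explicit fraction exposes its numerator and denominator.
fromℕ≡mkℚ : ∀ n → fromℕ n ≡ mkℚ (+ n) 0 (Coprime.sym (1-coprimeTo n))
fromℕ≡mkℚ n = ℚ.↥p/↧p≡p (mkℚ (+ n) 0 (Coprime.sym (1-coprimeTo n)))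

fromℕ-mono-< : ∀ {m n} → m < n → fromℕ m ℚ.< fromℕ n
fromℕ-mono-< {m} {n} m<n rewrite fromℕ≡mkℚ m | fromℕ≡mkℚ n =
  *<* (ℤ.*-monoʳ-<-pos (+ 1) (ℤ.+<+ m<n))

fromℕ-cancel-< : ∀ {m n} → fromℕ m ℚ.< fromℕ n → m < n
fromℕ-cancel-< {m} {n} m<n rewrite fromℕ≡mkℚ m | fromℕ≡mkℚ n =
  ℤ.drop‿+<+ (ℤ.*-cancelʳ-<-nonNeg (+ 1) (ℚ.drop-*<* m<n))

fromℕ-mono-≤ : ∀ {m n} → m ≤ n → fromℕ m ℚ.≤ fromℕ n
fromℕ-mono-≤ {m} {n} m≤n = ℚ.≮⇒≥ λ n<m → <⇒≱ (fromℕ-cancel-< n<m) m≤n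

fromℕ-homo-* : ∀ m n → fromℕ (m * n) ≡ fromℕ m ℚ.* fromℕ n
fromℕ-homo-* m n rewrite fromℕ≡mkℚ m | fromℕ≡mkℚ n = cong (ℚ._/ 1) (ℤ.pos-* m n)

fromℕ-homo-^ : ∀ m k → fromℕ (m ^ k) ≡ fromℕ m ^ℚ k
fromℕ-homo-^ m zero    = refl
fromℕ-homo-^ m (suc k) = trans (fromℕ-homo-* m (m ^ k)) (cong (fromℕ m ℚ.*_) (fromℕ-homo-^ m k))

-- A fraction `k / (d + 1)` with `k ≥ 0` lies below `k + 1`; a negative one lies below 0.
archimedean : ∀ q → ∃[ n ] q ℚ.< fromℕ n
archimedean q@(mkℚ (+ k) d _) = suc k , subst (q ℚ.<_) (sym (fromℕ≡mkℚ (suc k)))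
  (*<* (subst₂ ℤ._<_ (sym (ℤ.*-identityʳ (+ k))) (ℤ.pos-* (suc k) (suc d)) (ℤ.+<+ (m≤m*n (suc k) (suc d)))))
archimedean q@(mkℚ -[1+ _ ] _ _) = 0 , ℚ.negative⁻¹ q

upper-fromℕ : (x : ℝ) → ∃[ n ] upper (cut x) (fromℕ n)
upper-fromℕ x with u , x<u ← ℝ.upper-inhabited x with n , u<n ← archimedean u =
  n , Equivalence.from (ℝ.upper-rounded x (fromℕ n)) (u , u<n , x<u)

-- Rational powers and roots as cuts.

^ℚ-monoˡ-< : ∀ {q r} → 0ℚ ℚ.≤ q → q ℚ.< r → ∀ k → q ^ℚ suc k ℚ.< r ^ℚ suc k
^ℚ-monoˡ-< {q} {r} 0≤q q<r k = begin-strict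
  q ℚ.* q ^ℚ k   ≤⟨ ℚ.*-monoˡ-≤-nonNeg q (^-mono-≤ k) ⟩
  q ℚ.* r ^ℚ k   <⟨ ℚ.*-monoˡ-<-pos (r ^ℚ k) {{^-pos k}} q<r ⟩
  r ℚ.* r ^ℚ k   ∎
  where
  open ℚ.≤-Reasoning
  instance
    _ = ℚ.nonNegative 0≤q
    _ = ℚ.positive (ℚ.≤-<-trans 0≤q q<r)
  ^-pos : ∀ k → ℚ.Positive (r ^ℚ k)
  ^-pos zero    = _
  ^-pos (suc k) = ℚ.pos*pos⇒pos r (r ^ℚ k) {{^-pos k}}
  ^-mono-≤ : ∀ k → q ^ℚ k ℚ.≤ r ^ℚ k
  ^-mono-≤ zero    = ℚ.≤-refl
  ^-mono-≤ (suc k) = ℚ.≤-trans (ℚ.*-monoˡ-≤-nonNeg q (^-mono-≤ k))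
    (ℚ.*-monoʳ-≤-nonNeg (r ^ℚ k) {{ℚ.pos⇒nonNeg (r ^ℚ k) {{^-pos k}}}} (ℚ.<⇒≤ q<r))

-- Built with the constructor so that its numerator 1 and denominator `suc M` compute inside the
-- definition of `_^ᶜ_`.
1/[1+_] : ℕ → ℚ
1/[1+ M ] = mkℚ (+ 1) M (1-coprimeTo (suc M))

1/[1+M]*M<1 : ∀ M → 1/[1+ M ] ℚ.* fromℕ M ℚ.< 1ℚ
1/[1+M]*M<1 M = begin-strict
  1/[1+ M ] ℚ.* fromℕ M       <⟨ ℚ.*-monoʳ-<-pos 1/[1+ M ] (fromℕ-mono-< (n<1+n M)) ⟩
  1/[1+ M ] ℚ.* fromℕ (suc M) ≡⟨ cong (1/[1+ M ] ℚ.*_) (fromℕ≡mkℚ (suc M)) ⟩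
  1/[1+ M ] ℚ.* 1+M           ≡⟨ ℚ.*-inverseˡ 1+M ⟩
  1ℚ                          ∎
  where
  open ℚ.≤-Reasoning
  1+M : ℚ
  1+M = mkℚ (+ suc M) 0 (Coprime.sym (1-coprimeTo (suc M)))

-- The exponent `1/(M+1)` lies below `1/x`, as `x < M` and `M/(M+1) < 1`. For `0 ≤ q < m` it then
-- suffices that `q^(M+1) < m^(M+1) ≤ n`.
nat≤ᶜ^ᶜ1/ᶜ : ∀ {x M m n} → upper x (fromℕ M) → m ^ suc M ≤ n → nat m ≤ᶜ n ^ᶜ (1/ᶜ x)
nat≤ᶜ^ᶜ1/ᶜ {M = M} {m} {n} x<M mᴹ⁺¹≤n q q<m =
  1/[1+ M ] , (fromℕ M , x<M , 1/[1+M]*M<1 M) , ℚ.<⇒≤ (ℚ.positive⁻¹ 1/[1+ M ]) , q^[1+M]<n^1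
  where
  q^[1+M]<n^1 : q ℚ.< 0ℚ ⊎ q ^ℚ suc M ℚ.< fromℕ n ^ℚ 1
  q^[1+M]<n^1 with q ℚ.<? 0ℚ
  ... | yes q<0 = inj₁ q<0
  ... | no  q≮0 = inj₂ (begin-strict
    q ^ℚ suc M       <⟨ ^ℚ-monoˡ-< (ℚ.≮⇒≥ q≮0) q<m M ⟩
    fromℕ m ^ℚ suc M ≡⟨ fromℕ-homo-^ m (suc M) ⟨
    fromℕ (m ^ suc M) ≤⟨ fromℕ-mono-≤ mᴹ⁺¹≤n ⟩
    fromℕ n          ≡⟨ ℚ.*-identityʳ (fromℕ n) ⟨
    fromℕ n ^ℚ 1     ∎)
    where open ℚ.≤-Reasoning

-- The uniform threshold.

theorem1p1 : (μ : ℝ) → nat 0 <ᶜ cut μ →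
    (n p j : ℕ → ℕ) .{{_ : ∀ {k} → NonZero (n k)}} →
    (∀ k → Prime (p k)) →
    (∀ k → NonZero (j k)) →
    (∀ k → n k ≡ p k ^ j k) →
    (E : ℝ) → nat 0 <ᶜ cut E →
    ∃[ A ] nat 0 <ᶜ cut A × (∀ k → cut A <ᶜ nat (j k) → cut E <ᶜ T (n k) μ)
theorem1p1 μ _ n p j primes _ n≡p^j E _
  with M , μ<M ← upper-fromℕ μ
  with B , E<B ← upper-fromℕ E
  -- The threshold depends on `μ` and `E` only through the integers `M` and `B` above them. Using
  -- `suc N` makes its positivity immediate.
  = fromℚ (fromℕ (suc N)) , 0<A , E<T
  where
  N = suc M * 3 * (suc M * 3) * B
  0<A : nat 0 <ᶜ nat (suc N)
  0<A = ℚ.<-dense (fromℕ-mono-< {0} {suc N} (s≤s z≤n))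
  E<T : ∀ k → nat (suc N) <ᶜ nat (j k) → cut E <ᶜ T (n k) μ
  E<T k (q , A<q , q<j)
    with m , 1≤m , mᴹ⁺¹≤pʲ , B*τ<τ ← ∃-shift-with-many-divisors (primes k) (j k) M B
           (<⇒≤ (<-trans (n<1+n N) (fromℕ-cancel-< {suc N} {j k} (ℚ.<-trans A<q q<j))))
    rewrite sym (n≡p^j k) =
    -- The rational `B` separates `E` from the quotient: lying below `T (n k) μ` means that
    -- `B * τ (n k)` is less than `τ (n k + m)` for some admissible `m`.
    fromℕ B , E<B , m , (1≤m , nat≤ᶜ^ᶜ1/ᶜ {cut μ} {M} {m} μ<M mᴹ⁺¹≤pʲ) ,
    subst (ℚ._< fromℕ (τ (n k + m))) (fromℕ-homo-* B (τ (n k))) (fromℕ-mono-< B*τ<τ)
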